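{- $\frac{9-3\sqrt{5}}{4}\le a_{3,2}$.
   Context: Let $H_{n,3}=\{0,1,\dots,n-1\}^3$. A $2$-rook is a point $P\in H_{n,3}$ together with a set $D$ of $2$ of the $3$ coordinate indices; it covers $P$ itself and every point of $H_{n,3}$ which differs from $P$ in exactly one coordinate, that coordinate belonging to $D$. Distinct rooks must occupy distinct points. $a_{n,3,2}$ is the minimum number of $2$-rooks whose covered sets together cover $H_{n,3}$, and $a_{3,2}=\lim_{n\to\infty} a_{n,3,2}/n^{2}$ (this limit exists). -}

module Defs where

open import Data.Nat using (ℕ; _+_; _*_; _∸_; _^_; _≤_; _<_)
open import Data.Fin using (Fin)
open import Data.Fin.Subset using (Subset; _∈_; ∣_∣)
open import Data.Vec using (Vec; lookup)
open import Data.List using (List; length; map)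
open import Data.List.Relation.Unary.All using (All)
open import Data.List.Relation.Unary.Any using (Any)
open import Data.List.Relation.Unary.Unique.Propositional using (Unique)
open import Data.Product using (Σ; _×_; _,_; proj₁; proj₂; ∃)
open import Data.Sum using (_⊎_)
open import Relation.Binary.PropositionalEquality using (_≡_; _≢_)

Point : ℕ → Set
Point n = Vec (Fin n) 3

record Rook (n : ℕ) : Set where
  constructor rook
  field
    pos  : Point n
    dirs : Subset 3
    dirs-size : ∣ dirs ∣ ≡ 2
open Rook public

DiffersExactlyAt : {n : ℕ} → Point n → Point n → Fin 3 → Set
DiffersExactlyAt P Q i = (lookup Q i ≢ lookup P i) × (∀ j → j ≢ i → lookup Q j ≡ lookup P j)

Covers : {n : ℕ} → Rook n → Point n → Set
Covers r Q = (Q ≡ pos r) ⊎ (Σ (Fin 3) λ i → (i ∈ dirs r) × DiffersExactlyAt (pos r) Q i)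

IsCovering : (n : ℕ) → List (Rook n) → Set
IsCovering n rs = Unique (map pos rs) × (∀ (Q : Point n) → Any (λ r → Covers r Q) rs)

IsA : ℕ → ℕ → Set
IsA n m = (Σ (List (Rook n)) λ rs → IsCovering n rs × length rs ≡ m)
        × (∀ (rs : List (Rook n)) → IsCovering n rs → m ≤ length rs)

-- The rational a/b (b > 0) is strictly below (9 - 3√5)/4,
-- i.e. 4a < 9b - 3√5 b, i.e. 4a < 9b and 45 b² < (9b - 4a)².
BelowBound : ℕ → ℕ → Set
BelowBound a b = (4 * a < 9 * b) × (45 * (b * b) < (9 * b ∸ 4 * a) * (9 * b ∸ 4 * a))

{-# OPTIONS --safe #-}
module Submission where

-- A line of the cube is an edge of the complete tripartite graph on three copies of Fin n, and a
-- point is a triangle. A 2-rook deletes a cherry (two edges at one vertex, its centre, going to the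
-- two other classes), and the rooks cover the cube exactly when the kept graph is triangle-free.
-- Let mᵢ be the number of cherries centred in class i, m = Σ mᵢ and rᵢ = ⌊√(m - mᵢ)⌋. For a vertex v
-- of class i let a, b be its deleted degrees to the other classes, a₀, b₀ ≤ c those due to the c
-- cherries centred at v.
-- * Adjacent vertices have disjoint neighbourhoods in the third class, so summing over the kept
--   edges gives 2 Σᵥ (n - a)(n - b) ≤ n · #kept, that is 3n³ + 2 Σᵥ ab ≤ 3n · #deleted.
-- * All pairs of kept neighbours of v in the two other classes are deleted, so
--   (n - a)(n - b) ≤ m - mᵢ and therefore a ≥ n - rᵢ or b ≥ n - rᵢ; this implies
--   3n(a₀ + b₀) ≤ 2ab + (4n + 2rᵢ)c.
-- Summing over v yields 3n³ ≤ 4nm + 2 Σ rᵢmᵢ, and by Cauchy-Schwarz 3(Σ rᵢmᵢ)² ≤ 2m³. With t = m/n²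
-- this says 3(3 - 4t)² ≤ 8t³ or t ≥ 3/4, and 8t³ - 3(3 - 4t)² = (2t - 3)(4t² - 18t + 9).

open import Defs
open import Data.Bool using (true; false; if_then_else_)
open import Data.Empty using (⊥)
open import Data.Fin using (Fin; zero; suc; _≟_)
open import Data.Fin.Patterns using (0F; 1F; 2F)
open import Data.Fin.Subset using (_∈_)
open import Data.List using (List; []; _∷_; length; map)
open import Data.List.Membership.Propositional using (find) renaming (_∈_ to _∈ₗ_)
open import Data.List.Relation.Unary.Any using (Any; here; there)
open import Data.Nat hiding (_≟_)
open import Data.Nat.ListAction using () renaming (sum to sumᴸ)
open import Data.Nat.Properties hiding (_≟_)
open import Data.Nat.Tactic.RingSolver using (solve-∀)
open import Data.Product using (Σ; ∃; _×_; _,_; proj₁; proj₂)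
open import Data.Sum as Sum using (_⊎_; inj₁; inj₂)
open import Data.Vec using ([]; _∷_; lookup; here; there)
open import Data.Vec.Properties using ([]=⇒lookup)
open import Algebra.Properties.Semiring.Sum +-*-semiring
open import Relation.Binary.PropositionalEquality
open import Relation.Nullary using (does; yes; no; contradiction)
open import Relation.Nullary.Decidable using (dec-true)

-- Integer roots and quadratic inequalities in three variables.

-- Rounding the root down keeps the counting in `ℕ`. The lower estimate feeds `3w²≤2m³`; the upper
-- one, with `suc r`, feeds `small-degree`.
isqrt : ∀ m → ∃ λ r → r * r ≤ m × m < suc r * suc r
isqrt zero = 0 , z≤n , s≤s z≤n
isqrt (suc m) with isqrt m
... | r , r²≤m , m<[1+r]² with suc m <? suc r * suc r
...   | yes 1+m< = r , m≤n⇒m≤1+n r²≤m , 1+m<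
...   | no 1+m≮ = suc r , ≮⇒≥ 1+m≮ , ≤-<-trans m<[1+r]² (*-mono-< (n<1+n (suc r)) (n<1+n (suc r)))

2ab≤a²+b² : ∀ a b → 2 * (a * b) ≤ a * a + b * b
2ab≤a²+b² a b with ≤-total a b
... | inj₁ a≤b with m≤n⇒∃[o]m+o≡n a≤b
...   | c , refl = ≤-trans (m≤m+n _ (c * c)) (≤-reflexive (expand a c))
  where
  expand : ∀ a c → 2 * (a * (a + c)) + c * c ≡ a * a + (a + c) * (a + c)
  expand = solve-∀
2ab≤a²+b² a b | inj₂ b≤a with m≤n⇒∃[o]m+o≡n b≤a
...   | c , refl = ≤-trans (m≤m+n _ (c * c)) (≤-reflexive (expand b c))
  where
  expand : ∀ b c → 2 * ((b + c) * b) + c * c ≡ (b + c) * (b + c) + b * b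
  expand = solve-∀

m²<n²⇒m<n : ∀ m n → m * m < n * n → m < n
m²<n²⇒m<n m n m²<n² with m <? n
... | yes m<n = m<n
... | no m≮n = contradiction m²<n² (≤⇒≯ (*-mono-≤ (≮⇒≥ m≮n) (≮⇒≥ m≮n)))

-- Cauchy-Schwarz with weights mᵢ: the coefficients of mᵢ² agree on both sides, and those of mᵢmⱼ
-- differ by (rᵢ - rⱼ)².
cauchy : ∀ r₁ r₂ r₃ m₁ m₂ m₃ →
  let w = r₁ * m₁ + r₂ * m₂ + r₃ * m₃ in
  w * w ≤ (m₁ + m₂ + m₃) * (r₁ * r₁ * m₁ + r₂ * r₂ * m₂ + r₃ * r₃ * m₃)
cauchy r₁ r₂ r₃ m₁ m₂ m₃ = begin
  _ ≡⟨ expand r₁ r₂ r₃ m₁ m₂ m₃ ⟩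
  diag + (m₁ * m₂ * (2 * (r₁ * r₂)) + m₁ * m₃ * (2 * (r₁ * r₃)) + m₂ * m₃ * (2 * (r₂ * r₃)))
    ≤⟨ +-monoʳ-≤ diag (+-mono-≤ (+-mono-≤
         (*-monoʳ-≤ (m₁ * m₂) (2ab≤a²+b² r₁ r₂))
         (*-monoʳ-≤ (m₁ * m₃) (2ab≤a²+b² r₁ r₃)))
         (*-monoʳ-≤ (m₂ * m₃) (2ab≤a²+b² r₂ r₃))) ⟩
  _ ≡⟨ collect r₁ r₂ r₃ m₁ m₂ m₃ ⟩
  _ ∎
  where
  open ≤-Reasoning
  diag = r₁ * r₁ * (m₁ * m₁) + r₂ * r₂ * (m₂ * m₂) + r₃ * r₃ * (m₃ * m₃)
  expand : ∀ r₁ r₂ r₃ m₁ m₂ m₃ →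
    (r₁ * m₁ + r₂ * m₂ + r₃ * m₃) * (r₁ * m₁ + r₂ * m₂ + r₃ * m₃) ≡
    r₁ * r₁ * (m₁ * m₁) + r₂ * r₂ * (m₂ * m₂) + r₃ * r₃ * (m₃ * m₃) +
    (m₁ * m₂ * (2 * (r₁ * r₂)) + m₁ * m₃ * (2 * (r₁ * r₃)) + m₂ * m₃ * (2 * (r₂ * r₃)))
  expand = solve-∀
  collect : ∀ r₁ r₂ r₃ m₁ m₂ m₃ →
    r₁ * r₁ * (m₁ * m₁) + r₂ * r₂ * (m₂ * m₂) + r₃ * r₃ * (m₃ * m₃) +
    (m₁ * m₂ * (r₁ * r₁ + r₂ * r₂) + m₁ * m₃ * (r₁ * r₁ + r₃ * r₃) + m₂ * m₃ * (r₂ * r₂ + r₃ * r₃)) ≡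
    (m₁ + m₂ + m₃) * (r₁ * r₁ * m₁ + r₂ * r₂ * m₂ + r₃ * r₃ * m₃)
  collect = solve-∀

-- The right side minus the left is the sum of (mᵢ - mⱼ)² over the three pairs.
3Σmᵢ[m-mᵢ]≤2m² : ∀ m₁ m₂ m₃ →
  3 * ((m₂ + m₃) * m₁ + (m₃ + m₁) * m₂ + (m₁ + m₂) * m₃) ≤
  2 * ((m₁ + m₂ + m₃) * (m₁ + m₂ + m₃))
3Σmᵢ[m-mᵢ]≤2m² m₁ m₂ m₃ = begin
  _ ≡⟨ expand m₁ m₂ m₃ ⟩
  off + (2 * (m₁ * m₂) + 2 * (m₁ * m₃) + 2 * (m₂ * m₃))
    ≤⟨ +-monoʳ-≤ off (+-mono-≤ (+-mono-≤ (2ab≤a²+b² m₁ m₂) (2ab≤a²+b² m₁ m₃)) (2ab≤a²+b² m₂ m₃)) ⟩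
  _ ≡⟨ collect m₁ m₂ m₃ ⟩
  _ ∎
  where
  open ≤-Reasoning
  off = 4 * (m₁ * m₂) + 4 * (m₁ * m₃) + 4 * (m₂ * m₃)
  expand : ∀ m₁ m₂ m₃ →
    3 * ((m₂ + m₃) * m₁ + (m₃ + m₁) * m₂ + (m₁ + m₂) * m₃) ≡
    4 * (m₁ * m₂) + 4 * (m₁ * m₃) + 4 * (m₂ * m₃) +
    (2 * (m₁ * m₂) + 2 * (m₁ * m₃) + 2 * (m₂ * m₃))
  expand = solve-∀
  collect : ∀ m₁ m₂ m₃ →
    4 * (m₁ * m₂) + 4 * (m₁ * m₃) + 4 * (m₂ * m₃) +
    (m₁ * m₁ + m₂ * m₂ + (m₁ * m₁ + m₃ * m₃) + (m₂ * m₂ + m₃ * m₃)) ≡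
    2 * ((m₁ + m₂ + m₃) * (m₁ + m₂ + m₃))
  collect = solve-∀

3w²≤2m³ : ∀ r₁ r₂ r₃ m₁ m₂ m₃ →
  r₁ * r₁ ≤ m₂ + m₃ → r₂ * r₂ ≤ m₃ + m₁ → r₃ * r₃ ≤ m₁ + m₂ →
  let w = r₁ * m₁ + r₂ * m₂ + r₃ * m₃
      m = m₁ + m₂ + m₃ in
  3 * (w * w) ≤ 2 * (m * (m * m))
3w²≤2m³ r₁ r₂ r₃ m₁ m₂ m₃ h₁ h₂ h₃ = begin
  3 * (w * w)
    ≤⟨ *-monoʳ-≤ 3 (cauchy r₁ r₂ r₃ m₁ m₂ m₃) ⟩
  3 * (m * (r₁ * r₁ * m₁ + r₂ * r₂ * m₂ + r₃ * r₃ * m₃))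
    ≤⟨ *-monoʳ-≤ 3 (*-monoʳ-≤ m (+-mono-≤ (+-mono-≤
         (*-monoˡ-≤ m₁ h₁) (*-monoˡ-≤ m₂ h₂)) (*-monoˡ-≤ m₃ h₃))) ⟩
  3 * (m * s)           ≡⟨ swap 3 m s ⟩
  m * (3 * s)           ≤⟨ *-monoʳ-≤ m (3Σmᵢ[m-mᵢ]≤2m² m₁ m₂ m₃) ⟩
  m * (2 * (m * m))     ≡⟨ swap m 2 (m * m) ⟩
  2 * (m * (m * m))     ∎
  where
  open ≤-Reasoning
  w = r₁ * m₁ + r₂ * m₂ + r₃ * m₃
  m = m₁ + m₂ + m₃
  s = (m₂ + m₃) * m₁ + (m₃ + m₁) * m₂ + (m₁ + m₂) * m₃
  swap : ∀ x y z → x * (y * z) ≡ y * (x * z)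
  swap = solve-∀

-- Comparison with the irrational bound.

-- This transfers the bound from a/b to the density m/n² of a covering assumed too small, with `N` =
-- n². As 9 - 4x decreases in x, d/b ≤ D/N; clearing denominators gives `dN≤bD`.
BelowBound-mono : ∀ {a b m N} → 0 < b → 0 < N → b * m < a * N → BelowBound a b → BelowBound m N
BelowBound-mono {a} {b} {m} {N} 0<b 0<N bm<aN (4a<9b , 45b²<d²) = *-cancelˡ-< b _ _ b4m<b9N , 45N²<D²
  where
  open ≤-Reasoning
  D = 9 * N ∸ 4 * m
  d = 9 * b ∸ 4 * a
  instance
    _ = >-nonZero 0<b
    _ = >-nonZero 0<N
    _ = m*n≢0 N N
  swap : ∀ x y z → x * (y * z) ≡ y * (x * z)
  swap = solve-∀
  b4m<b9N : b * (4 * m) < b * (9 * N)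
  b4m<b9N = begin-strict
    b * (4 * m) ≡⟨ swap b 4 m ⟩
    4 * (b * m) <⟨ *-monoʳ-< 4 bm<aN ⟩
    4 * (a * N) ≡⟨ *-assoc 4 a N ⟨
    4 * a * N   ≤⟨ *-monoˡ-≤ N (<⇒≤ 4a<9b) ⟩
    9 * b * N   ≡⟨ *-assoc 9 b N ⟩
    9 * (b * N) ≡⟨ swap 9 b N ⟩
    b * (9 * N) ∎
  dN≤bD : d * N ≤ b * D
  dN≤bD = begin
    d * N                         ≡⟨ *-distribʳ-∸ N (9 * b) (4 * a) ⟩
    9 * b * N ∸ 4 * a * N         ≤⟨ ∸-monoʳ-≤ (9 * b * N) b4m≤4aN ⟩
    9 * b * N ∸ b * (4 * m)       ≡⟨ cong (_∸ b * (4 * m)) (trans (*-assoc 9 b N) (swap 9 b N)) ⟩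
    b * (9 * N) ∸ b * (4 * m)     ≡⟨ *-distribˡ-∸ b (9 * N) (4 * m) ⟨
    b * D                         ∎
    where
    b4m≤4aN : b * (4 * m) ≤ 4 * a * N
    b4m≤4aN = begin
      b * (4 * m) ≡⟨ swap b 4 m ⟩
      4 * (b * m) ≤⟨ *-monoʳ-≤ 4 (<⇒≤ bm<aN) ⟩
      4 * (a * N) ≡⟨ *-assoc 4 a N ⟨
      4 * a * N   ∎
  45N²<D² : 45 * (N * N) < D * D
  45N²<D² = *-cancelˡ-< (b * b) _ _ (begin-strict
    b * b * (45 * (N * N)) ≡⟨ regroup b N ⟩
    45 * (b * b) * (N * N) <⟨ *-monoˡ-< (N * N) 45b²<d² ⟩
    d * d * (N * N)        ≡⟨ square-product d N ⟩
    d * N * (d * N)        ≤⟨ *-mono-≤ dN≤bD dN≤bD ⟩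
    b * D * (b * D)        ≡⟨ square-product b D ⟨
    b * b * (D * D)        ∎)
    where
    regroup : ∀ b N → b * b * (45 * (N * N)) ≡ 45 * (b * b) * (N * N)
    regroup = solve-∀
    square-product : ∀ x y → x * x * (y * y) ≡ x * y * (x * y)
    square-product = solve-∀

-- With f = 4m and g = 3n² - 4m, the cubic 3n²(3n² - 4m)² ≤ 8m³ reads 8(f + g)g² ≤ f³,
-- while BelowBound m n² reads f² < 2fg + 4g².
¬cubic : ∀ {f g} → 0 < g → f * f < 2 * f * g + 4 * g * g → f * (f * f) < 8 * (f + g) * (g * g)
¬cubic {f} {g} 0<g h = begin-strict
  f * (f * f)                     ≤⟨ *-monoʳ-≤ f (<⇒≤ h) ⟩
  f * (2 * f * g + 4 * g * g)     ≡⟨ e₁ f g ⟩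
  2 * g * (f * f) + 4 * f * g * g <⟨ +-monoˡ-< (4 * f * g * g) (*-monoʳ-< (2 * g) h) ⟩
  2 * g * (2 * f * g + 4 * g * g) + 4 * f * g * g ≡⟨ e₂ f g ⟩
  8 * (f + g) * (g * g) ∎
  where
  open ≤-Reasoning
  instance
    _ = >-nonZero 0<g
    _ = m*n≢0 2 g
  e₁ : ∀ f g → f * (2 * f * g + 4 * g * g) ≡ 2 * g * (f * f) + 4 * f * g * g
  e₁ = solve-∀
  e₂ : ∀ f g → 2 * g * (2 * f * g + 4 * g * g) + 4 * f * g * g ≡ 8 * (f + g) * (g * g)
  e₂ = solve-∀

-- Eliminates `w`: the first hypothesis gives n·g ≤ 2w with g = 3n² - 4m, and squaring then yields
-- 24n²g² ≤ 64m³, contrary to `¬cubic`.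
¬BelowBound : ∀ n m w → 3 * (n * (n * n)) ≤ 4 * n * m + 2 * w →
  3 * (w * w) ≤ 2 * (m * (m * m)) → BelowBound m (n * n) → ⊥
¬BelowBound n m w 3n³≤ 3w²≤2m³ (f<9N , 45N²<D²) =
  <⇒≱ (¬cubic {f} {g} (m<n⇒0<n∸m 6N<D) f²<) (begin
    8 * (f + g) * (g * g)          ≡⟨ cong (λ z → 8 * z * (g * g)) 3N≡f+g ⟨
    8 * (3 * (n * n)) * (g * g)    ≡⟨ e₁ n g ⟩
    24 * (n * g * (n * g))         ≤⟨ *-monoʳ-≤ 24 (*-mono-≤ ng≤2w ng≤2w) ⟩
    24 * (2 * w * (2 * w))         ≡⟨ e₂ w ⟩
    32 * (3 * (w * w))             ≤⟨ *-monoʳ-≤ 32 3w²≤2m³ ⟩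
    32 * (2 * (m * (m * m)))       ≡⟨ e₃ m ⟩
    f * (f * f)                    ∎)
  where
  open ≤-Reasoning
  N = n * n
  f = 4 * m
  D = 9 * N ∸ f
  -- This is 3N - 4m. Since 36 < 45, the bound on D² gives `6N<D`, so the subtraction is exact and
  -- `g` is positive.
  g = D ∸ 6 * N
  6N<D : 6 * N < D
  6N<D = m²<n²⇒m<n (6 * N) D (≤-<-trans 36N²≤ 45N²<D²)
    where
    e : ∀ N → 6 * N * (6 * N) + 9 * (N * N) ≡ 45 * (N * N)
    e = solve-∀
    36N²≤ : 6 * N * (6 * N) ≤ 45 * (N * N)
    36N²≤ = ≤-trans (m≤m+n _ (9 * (N * N))) (≤-reflexive (e N))
  D≡ : D ≡ 6 * N + g
  D≡ = sym (m+[n∸m]≡n (<⇒≤ 6N<D))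
  3N≡f+g : 3 * N ≡ f + g
  3N≡f+g = +-cancelʳ-≡ (6 * N) _ _ (begin-equality
    3 * N + 6 * N   ≡⟨ e N ⟩
    9 * N           ≡⟨ m+[n∸m]≡n (<⇒≤ f<9N) ⟨
    f + D           ≡⟨ cong (f +_) D≡ ⟩
    f + (6 * N + g) ≡⟨ e′ f (6 * N) g ⟩
    f + g + 6 * N   ∎)
    where
    e : ∀ N → 3 * N + 6 * N ≡ 9 * N
    e = solve-∀
    e′ : ∀ f x g → f + (x + g) ≡ f + g + x
    e′ = solve-∀
  f²< : f * f < 2 * f * g + 4 * g * g
  -- With 3N = f + g and D = 2f + 3g, the hypothesis reads 5(f + g)² < (2f + 3g)²; the common part
  -- 4f² + 10fg + 5g² is cancelled.
  f²< = +-cancelˡ-< (4 * f * f + 10 * f * g + 5 * g * g) _ _ (begin-strict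
    4 * f * f + 10 * f * g + 5 * g * g + f * f ≡⟨ e₄ f g ⟩
    5 * ((f + g) * (f + g))                    ≡⟨ cong (λ z → 5 * (z * z)) 3N≡f+g ⟨
    5 * (3 * N * (3 * N))                      ≡⟨ e₅ N ⟩
    45 * (N * N)                               <⟨ 45N²<D² ⟩
    D * D                                      ≡⟨ cong (λ z → z * z) D≡ ⟩
    (6 * N + g) * (6 * N + g)                  ≡⟨ e₆ N g ⟩
    (2 * (3 * N) + g) * (2 * (3 * N) + g)      ≡⟨ cong (λ z → (2 * z + g) * (2 * z + g)) 3N≡f+g ⟩
    (2 * (f + g) + g) * (2 * (f + g) + g)      ≡⟨ e₇ f g ⟩
    4 * f * f + 10 * f * g + 5 * g * g + (2 * f * g + 4 * g * g) ∎)
    where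
    e₄ : ∀ f g → 4 * f * f + 10 * f * g + 5 * g * g + f * f ≡ 5 * ((f + g) * (f + g))
    e₄ = solve-∀
    e₅ : ∀ N → 5 * (3 * N * (3 * N)) ≡ 45 * (N * N)
    e₅ = solve-∀
    e₆ : ∀ N g → (6 * N + g) * (6 * N + g) ≡ (2 * (3 * N) + g) * (2 * (3 * N) + g)
    e₆ = solve-∀
    e₇ : ∀ f g → (2 * (f + g) + g) * (2 * (f + g) + g) ≡
                 4 * f * f + 10 * f * g + 5 * g * g + (2 * f * g + 4 * g * g)
    e₇ = solve-∀
  ng≤2w : n * g ≤ 2 * w
  ng≤2w = +-cancelˡ-≤ (4 * n * m) _ _ (begin
    4 * n * m + n * g ≡⟨ e n m g ⟩
    n * (f + g)       ≡⟨ cong (n *_) 3N≡f+g ⟨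
    n * (3 * N)       ≡⟨ e′ n ⟩
    3 * (n * N)       ≤⟨ 3n³≤ ⟩
    4 * n * m + 2 * w ∎)
    where
    e : ∀ n m g → 4 * n * m + n * g ≡ n * (4 * m + g)
    e = solve-∀
    e′ : ∀ n → n * (3 * (n * n)) ≡ 3 * (n * (n * n))
    e′ = solve-∀
  e₁ : ∀ n g → 8 * (3 * (n * n)) * (g * g) ≡ 24 * (n * g * (n * g))
  e₁ = solve-∀
  e₂ : ∀ w → 24 * (2 * w * (2 * w)) ≡ 32 * (3 * (w * w))
  e₂ = solve-∀
  e₃ : ∀ m → 32 * (2 * (m * (m * m))) ≡ 4 * m * (4 * m * (4 * m))
  e₃ = solve-∀

-- Matrix sums and edge counts in bipartite graphs.

∑-mono : ∀ {n} {f g : Fin n → ℕ} → (∀ i → f i ≤ g i) → sum f ≤ sum g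
∑-mono {zero}  f≤g = z≤n
∑-mono {suc n} f≤g = +-mono-≤ (f≤g zero) (∑-mono (λ i → f≤g (suc i)))

∑-const : ∀ n k → ∑[ i < n ] k ≡ n * k
∑-const zero    k = refl
∑-const (suc n) k = cong (k +_) (∑-const n k)

Matrix : ℕ → Set
Matrix n = Fin n → Fin n → ℕ

module _ {n : ℕ} where

  row col : Matrix n → Fin n → ℕ
  row A u = ∑[ v < n ] A u v
  col A v = ∑[ u < n ] A u v

  total : Matrix n → ℕ
  total A = ∑[ u < n ] row A u

  infixl 6 _⊕_
  _⊕_ : Matrix n → Matrix n → Matrix n
  (A ⊕ B) u v = A u v + B u v

  -- Entries are multiplicities, since several cherries may share an edge. These are the 0-1
  -- indicators of positive and of zero entries.
  deleted kept : Matrix n → Matrix n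
  deleted A u v = A u v ⊓ 1
  kept    A u v = 1 ∸ A u v

  total-mono : ∀ {A B} → (∀ u v → A u v ≤ B u v) → total A ≤ total B
  total-mono A≤B = ∑-mono λ u → ∑-mono λ v → A≤B u v

  total-⊕ : ∀ A B → total (A ⊕ B) ≡ total A + total B
  total-⊕ A B = trans (sum-cong-≗ λ u → ∑-distrib-+ (A u) (B u)) (∑-distrib-+ (row A) (row B))

  total-col : ∀ A → total A ≡ ∑[ v < n ] col A v
  total-col A = ∑-comm A

  row-kept : ∀ A u → row (kept A) u + row (deleted A) u ≡ n
  row-kept A u = begin
    row (kept A) u + row (deleted A) u          ≡⟨ ∑-distrib-+ (kept A u) (deleted A u) ⟨
    ∑[ v < n ] (kept A u v + deleted A u v)     ≡⟨ sum-cong-≗ (λ v → trans (+-comm (kept A u v) _) (m⊓n+n∸m≡n (A u v) 1)) ⟩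
    ∑[ v < n ] 1                                ≡⟨ trans (∑-const n 1) (*-identityʳ n) ⟩
    n                                           ∎
    where open ≡-Reasoning

  total-kept : ∀ A → total (kept A) + total (deleted A) ≡ n * n
  total-kept A = begin
    total (kept A) + total (deleted A)                  ≡⟨ ∑-distrib-+ (row (kept A)) (row (deleted A)) ⟨
    ∑[ u < n ] (row (kept A) u + row (deleted A) u)     ≡⟨ sum-cong-≗ (row-kept A) ⟩
    ∑[ u < n ] n                                        ≡⟨ ∑-const n n ⟩
    n * n                                               ∎
    where open ≡-Reasoning

  total-deleted-⊕ : ∀ A B → total (deleted (A ⊕ B)) ≤ total (deleted A) + total (deleted B)
  total-deleted-⊕ A B = ≤-trans (total-mono λ u v → ⊓1-subadditive (A u v) (B u v))
                                (≤-reflexive (total-⊕ (deleted A) (deleted B)))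
    where
    ⊓1-subadditive : ∀ a b → (a + b) ⊓ 1 ≤ a ⊓ 1 + b ⊓ 1
    ⊓1-subadditive zero    b = ≤-refl
    ⊓1-subadditive (suc a) b rewrite ⊓-zeroʳ (a + b) = s≤s z≤n

  paths : Matrix n → Matrix n → ℕ
  paths A B = ∑[ v < n ] (col A v * row B v)

  -- At each middle vertex, with a and b the deleted degrees, this is (n - a)(n - b) + n(a + b) = n²
  -- + ab.
  paths-kept : ∀ A B → paths (kept A) (kept B) + n * (total (deleted A) + total (deleted B)) ≡
                       n * (n * n) + paths (deleted A) (deleted B)
  paths-kept A B = begin
    paths (kept A) (kept B) + n * (total (deleted A) + total (deleted B))
      ≡⟨ cong (λ z → paths (kept A) (kept B) + n * z) (trans (cong (_+ total (deleted B)) (total-col (deleted A))) (sym (∑-distrib-+ a b))) ⟩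
    paths (kept A) (kept B) + n * ∑[ v < n ] (a v + b v)
      ≡⟨ cong (paths (kept A) (kept B) +_) (*-distribˡ-sum n (λ v → a v + b v)) ⟩
    paths (kept A) (kept B) + ∑[ v < n ] (n * (a v + b v))
      ≡⟨ ∑-distrib-+ (λ v → ka v * kb v) (λ v → n * (a v + b v)) ⟨
    ∑[ v < n ] (ka v * kb v + n * (a v + b v))
      ≡⟨ sum-cong-≗ (λ v → product (ka v) (a v) (kb v) (b v) (row-kept (λ x y → A y x) v) (row-kept B v)) ⟩
    ∑[ v < n ] (n * n + a v * b v)
      ≡⟨ ∑-distrib-+ (λ _ → n * n) (λ v → a v * b v) ⟩
    ∑[ v < n ] (n * n) + paths (deleted A) (deleted B)
      ≡⟨ cong (_+ paths (deleted A) (deleted B)) (∑-const n (n * n)) ⟩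
    n * (n * n) + paths (deleted A) (deleted B) ∎
    where
    open ≡-Reasoning
    a = col (deleted A)
    b = row (deleted B)
    ka = col (kept A)
    kb = row (kept B)
    product : ∀ k a l b → k + a ≡ n → l + b ≡ n → k * l + n * (a + b) ≡ n * n + a * b
    product k a l b h h′ = begin
      k * l + n * (a + b)           ≡⟨ cong (k * l +_) (*-distribˡ-+ n a b) ⟩
      k * l + (n * a + n * b)       ≡⟨ cong₂ (λ y z → k * l + (y * a + z * b)) h′ h ⟨
      k * l + ((l + b) * a + (k + a) * b) ≡⟨ e k a l b ⟩
      (k + a) * (l + b) + a * b     ≡⟨ cong₂ (λ y z → y * z + a * b) h h′ ⟩
      n * n + a * b                 ∎
      where
      e : ∀ k a l b → k * l + ((l + b) * a + (k + a) * b) ≡ (k + a) * (l + b) + a * b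
      e = solve-∀

  -- The two ends of a kept edge have disjoint neighbourhoods in the third class.
  paths-triangle-free : ∀ K₁ K₂ K₃ → (∀ x y z → K₂ y z * (K₁ x y + K₃ z x) ≤ K₂ y z) →
                        paths K₁ K₂ + paths K₂ K₃ ≤ n * total K₂
  paths-triangle-free K₁ K₂ K₃ h = begin
    paths K₁ K₂ + paths K₂ K₃
      ≡⟨ cong₂ _+_ left right ⟩
    ∑[ y < n ] ∑[ z < n ] (K₂ y z * col K₁ y) + ∑[ y < n ] ∑[ z < n ] (K₂ y z * row K₃ z)
      ≡⟨ total-⊕ (λ y z → K₂ y z * col K₁ y) (λ y z → K₂ y z * row K₃ z) ⟨
    ∑[ y < n ] ∑[ z < n ] (K₂ y z * col K₁ y + K₂ y z * row K₃ z)
      ≡⟨ sum-cong-≗ (λ y → sum-cong-≗ (λ z → inner y z)) ⟩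
    ∑[ y < n ] ∑[ z < n ] ∑[ x < n ] (K₂ y z * (K₁ x y + K₃ z x))
      ≤⟨ total-mono (λ y z → ∑-mono (λ x → h x y z)) ⟩
    ∑[ y < n ] ∑[ z < n ] ∑[ x < n ] (K₂ y z)
      ≡⟨ sum-cong-≗ (λ y → trans (sum-cong-≗ (λ z → ∑-const n (K₂ y z))) (sym (*-distribˡ-sum n (K₂ y)))) ⟩
    ∑[ y < n ] (n * row K₂ y)
      ≡⟨ *-distribˡ-sum n (row K₂) ⟨
    n * total K₂ ∎
    where
    open ≤-Reasoning
    left : paths K₁ K₂ ≡ ∑[ y < n ] ∑[ z < n ] (K₂ y z * col K₁ y)
    left = sum-cong-≗ λ y → trans (*-comm (col K₁ y) (row K₂ y)) (*-distribʳ-sum (col K₁ y) (K₂ y))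
    right : paths K₂ K₃ ≡ ∑[ y < n ] ∑[ z < n ] (K₂ y z * row K₃ z)
    right = trans (sum-cong-≗ λ z → *-distribʳ-sum (row K₃ z) (λ y → K₂ y z))
                  (∑-comm (λ z y → K₂ y z * row K₃ z))
    inner : ∀ y z → K₂ y z * col K₁ y + K₂ y z * row K₃ z ≡ ∑[ x < n ] (K₂ y z * (K₁ x y + K₃ z x))
    inner y z = trans (sym (*-distribˡ-+ (K₂ y z) (col K₁ y) (row K₃ z)))
               (trans (cong (K₂ y z *_) (sym (∑-distrib-+ (λ x → K₁ x y) (K₃ z))))
                      (*-distribˡ-sum (K₂ y z) (λ x → K₁ x y + K₃ z x)))

  -- Expanding the product gives one term for each pair (z , x), so distinct pairs of kept
  -- neighbours are charged to distinct entries of `D`.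
  degrees-product : ∀ K₁ K₂ (D : Matrix n) → (∀ x y z → K₁ x y * K₂ y z ≤ D z x) →
                    ∀ y → col K₁ y * row K₂ y ≤ total D
  degrees-product K₁ K₂ D h y = begin
    col K₁ y * row K₂ y                     ≡⟨ *-distribˡ-sum (col K₁ y) (K₂ y) ⟩
    ∑[ z < n ] (col K₁ y * K₂ y z)          ≡⟨ sum-cong-≗ (λ z → *-distribʳ-sum (K₂ y z) (λ x → K₁ x y)) ⟩
    ∑[ z < n ] ∑[ x < n ] (K₁ x y * K₂ y z) ≤⟨ total-mono (λ z x → h x y z) ⟩
    total D                                 ∎
    where open ≤-Reasoning

-- Deletions at a single vertex.

-- If both kept degrees exceeded r, their product would be at least (r + 1)².
small-degree : ∀ {n r M} k a l b → k + a ≡ n → l + b ≡ n → k * l ≤ M → M < suc r * suc r →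
               n ≤ a + r ⊎ n ≤ b + r
small-degree {r = r} k a l b refl l+b≡n kl≤M M<[1+r]² with k ≤? r
... | yes k≤r = inj₁ (≤-trans (+-monoˡ-≤ a k≤r) (≤-reflexive (+-comm r a)))
... | no k≰r with l ≤? r
...   | yes l≤r = inj₂ (≤-trans (≤-reflexive (sym l+b≡n)) (≤-trans (+-monoˡ-≤ b l≤r) (≤-reflexive (+-comm r b))))
...   | no l≰r = contradiction (≤-<-trans kl≤M M<[1+r]²) (≤⇒≯ (*-mono-≤ (≰⇒> k≰r) (≰⇒> l≰r)))

-- It suffices to bound 3n·b₀ by 2ab + (n + 2r)a₀. Split 3n as n + 2n and replace 2n by 2(a + r),
-- using b₀ ≤ b; or, after enlarging b₀ to a₀, by 2(b + r), using a₀ ≤ a. The factor a₀ is raised to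
-- c only at the end.
vertex-inequality-ordered : ∀ {n r c a b a₀ b₀} → b₀ ≤ a₀ → a₀ ≤ c → a₀ ≤ a → b₀ ≤ b →
  n ≤ a + r ⊎ n ≤ b + r → 3 * n * (a₀ + b₀) ≤ 2 * (a * b) + (4 * n + 2 * r) * c
vertex-inequality-ordered {n} {r} {c} {a} {b} {a₀} {b₀} b₀≤a₀ a₀≤c a₀≤a b₀≤b near = begin
  3 * n * (a₀ + b₀)                                ≡⟨ e₁ n a₀ b₀ ⟩
  3 * n * a₀ + 3 * n * b₀                          ≤⟨ +-monoʳ-≤ (3 * n * a₀) (core near) ⟩
  3 * n * a₀ + (2 * (a * b) + (n + 2 * r) * a₀)    ≡⟨ e₂ n r a b a₀ ⟩
  2 * (a * b) + (4 * n + 2 * r) * a₀               ≤⟨ +-monoʳ-≤ (2 * (a * b)) (*-monoʳ-≤ (4 * n + 2 * r) a₀≤c) ⟩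
  2 * (a * b) + (4 * n + 2 * r) * c                ∎
  where
  open ≤-Reasoning
  e₁ : ∀ n a₀ b₀ → 3 * n * (a₀ + b₀) ≡ 3 * n * a₀ + 3 * n * b₀
  e₁ = solve-∀
  e₂ : ∀ n r a b a₀ → 3 * n * a₀ + (2 * (a * b) + (n + 2 * r) * a₀) ≡ 2 * (a * b) + (4 * n + 2 * r) * a₀
  e₂ = solve-∀
  e₃ : ∀ n x → 3 * n * x ≡ n * x + 2 * n * x
  e₃ = solve-∀
  e₄ : ∀ n r x y → n * x + 2 * (y + r) * x ≡ 2 * (y * x) + (n + 2 * r) * x
  e₄ = solve-∀
  core : n ≤ a + r ⊎ n ≤ b + r → 3 * n * b₀ ≤ 2 * (a * b) + (n + 2 * r) * a₀
  core (inj₁ n≤a+r) = begin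
    3 * n * b₀                       ≡⟨ e₃ n b₀ ⟩
    n * b₀ + 2 * n * b₀              ≤⟨ +-monoʳ-≤ (n * b₀) (*-monoˡ-≤ b₀ (*-monoʳ-≤ 2 n≤a+r)) ⟩
    n * b₀ + 2 * (a + r) * b₀        ≡⟨ e₄ n r b₀ a ⟩
    2 * (a * b₀) + (n + 2 * r) * b₀  ≤⟨ +-mono-≤ (*-monoʳ-≤ 2 (*-monoʳ-≤ a b₀≤b)) (*-monoʳ-≤ (n + 2 * r) b₀≤a₀) ⟩
    2 * (a * b) + (n + 2 * r) * a₀   ∎
  core (inj₂ n≤b+r) = begin
    3 * n * b₀                       ≤⟨ *-monoʳ-≤ (3 * n) b₀≤a₀ ⟩
    3 * n * a₀                       ≡⟨ e₃ n a₀ ⟩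
    n * a₀ + 2 * n * a₀              ≤⟨ +-monoʳ-≤ (n * a₀) (*-monoˡ-≤ a₀ (*-monoʳ-≤ 2 n≤b+r)) ⟩
    n * a₀ + 2 * (b + r) * a₀        ≡⟨ e₄ n r a₀ b ⟩
    2 * (b * a₀) + (n + 2 * r) * a₀  ≤⟨ +-monoˡ-≤ ((n + 2 * r) * a₀) (*-monoʳ-≤ 2 (≤-trans (*-monoʳ-≤ b a₀≤a) (≤-reflexive (*-comm b a)))) ⟩
    2 * (a * b) + (n + 2 * r) * a₀   ∎

vertex-inequality : ∀ {n r c a b} a₀ b₀ → a₀ ≤ c → b₀ ≤ c → a₀ ≤ a → b₀ ≤ b →
  n ≤ a + r ⊎ n ≤ b + r → 3 * n * (a₀ + b₀) ≤ 2 * (a * b) + (4 * n + 2 * r) * c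
vertex-inequality {n} {r} {c} {a} {b} a₀ b₀ a₀≤c b₀≤c a₀≤a b₀≤b near with ≤-total b₀ a₀
... | inj₁ b₀≤a₀ = vertex-inequality-ordered b₀≤a₀ a₀≤c a₀≤a b₀≤b near
... | inj₂ a₀≤b₀ = subst₂ _≤_ (cong (3 * n *_) (+-comm b₀ a₀))
                              (cong (λ z → 2 * z + (4 * n + 2 * r) * c) (*-comm b a))
                              (vertex-inequality-ordered a₀≤b₀ b₀≤c b₀≤b a₀≤a (Sum.swap near))

-- Counting in the tripartite graph.

next : Fin 3 → Fin 3
next 0F = 1F
next 1F = 2F
next 2F = 0F

-- Class next i is the successor of class i in the cyclic order, and P i and Q i count, for each
-- pair u in class i and v in class next i, the cherries through uv centred at u and at v.
module Cherries {n : ℕ} (P Q : Fin 3 → Matrix n) (c : Fin 3 → Fin n → ℕ)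
  (row-P : ∀ i u → row (P i) u ≡ c i u)
  (col-Q : ∀ i v → col (Q i) v ≡ c (next i) v)
  (hit : ∀ i x y z → 0 < (P i ⊕ Q i) x y + ((P (next i) ⊕ Q (next i)) y z +
                         (P (next (next i)) ⊕ Q (next (next i))) z x))
  where

  N K D : Fin 3 → Matrix n
  N i = P i ⊕ Q i
  K i = kept (N i)
  D i = deleted (N i)

  m : Fin 3 → ℕ
  m i = ∑[ u < n ] c i u

  r : Fin 3 → ℕ
  r i = proj₁ (isqrt (m (next i) + m (next (next i))))

  r²≤ : ∀ i → r i * r i ≤ m (next i) + m (next (next i))
  r²≤ i = proj₁ (proj₂ (isqrt (m (next i) + m (next (next i)))))

  <[1+r]² : ∀ i → m (next i) + m (next (next i)) < suc (r i) * suc (r i)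
  <[1+r]² i = proj₂ (proj₂ (isqrt (m (next i) + m (next (next i)))))

  col-deleted-Q : ∀ i v → col (deleted (Q i)) v ≤ c (next i) v
  col-deleted-Q i v = ≤-trans (∑-mono λ u → m⊓n≤m (Q i u v) 1) (≤-reflexive (col-Q i v))

  row-deleted-P : ∀ i u → row (deleted (P i)) u ≤ c i u
  row-deleted-P i u = ≤-trans (∑-mono λ v → m⊓n≤m (P i u v) 1) (≤-reflexive (row-P i u))

  total-deleted : ∀ i → total (D i) ≤ total (deleted (P i)) + total (deleted (Q i))
  total-deleted i = total-deleted-⊕ (P i) (Q i)

  -- A cherry centred in class `i` or `next i` deletes one edge between these classes; a cherry
  -- centred in the third class deletes none there.
  total-D≤ : ∀ i → total (D i) ≤ m i + m (next i)
  total-D≤ i = ≤-trans (total-deleted i) (+-mono-≤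
    (∑-mono (row-deleted-P i))
    (≤-trans (≤-reflexive (total-col (deleted (Q i)))) (∑-mono (col-deleted-Q i))))

  private
    -- If the middle edge is kept, at least one of the other two is deleted, so their kept
    -- indicators sum to at most one.
    disjoint : ∀ a b c → 0 < a + (b + c) → (1 ∸ b) * ((1 ∸ a) + (1 ∸ c)) ≤ 1 ∸ b
    disjoint a       (suc b) c       _ rewrite 0∸n≡0 b = z≤n
    disjoint (suc a) zero    c       _ rewrite 0∸n≡0 a = ≤-trans (≤-reflexive (+-identityʳ (1 ∸ c))) (m∸n≤m 1 c)
    disjoint zero    zero    (suc c) _ rewrite 0∸n≡0 c = ≤-refl

    third-deleted : ∀ a b c → 0 < a + (b + c) → (1 ∸ a) * (1 ∸ b) ≤ c ⊓ 1
    third-deleted (suc a) b       c       _ rewrite 0∸n≡0 a = z≤n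
    third-deleted zero    (suc b) c       _ rewrite 0∸n≡0 b = z≤n
    third-deleted zero    zero    (suc c) _ = s≤s z≤n

  kept-paths : ∀ i → paths (K i) (K (next i)) + paths (K (next i)) (K (next (next i))) ≤ n * total (K (next i))
  kept-paths i = paths-triangle-free (K i) (K (next i)) (K (next (next i))) λ x y z →
    disjoint (N i x y) (N (next i) y z) (N (next (next i)) z x) (hit i x y z)

  near : ∀ i v → n ≤ col (D i) v + r (next i) ⊎ n ≤ row (D (next i)) v + r (next i)
  near i v = small-degree (col (K i) v) _ (row (K (next i)) v) _
    (row-kept (λ y x → N i x y) v) (row-kept (N (next i)) v)
    (≤-trans (degrees-product (K i) (K (next i)) (D (next (next i)))
                (λ x y z → third-deleted (N i x y) (N (next i) y z) _ (hit i x y z)) v)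
             (total-D≤ (next (next i))))
    (<[1+r]² (next i))

  -- `Q i` and `P (next i)` record the two arms of the cherries centred in class `next i`;
  -- `vertex-inequality` is summed over that class.
  own-deletions : ∀ i → 3 * n * (total (deleted (Q i)) + total (deleted (P (next i)))) ≤
                        2 * paths (D i) (D (next i)) + (4 * n + 2 * r (next i)) * m (next i)
  own-deletions i = begin
    3 * n * (total (deleted (Q i)) + total (deleted (P j)))
      ≡⟨ cong (3 * n *_) (trans (cong (_+ total (deleted (P j))) (total-col (deleted (Q i)))) (sym (∑-distrib-+ a₀ b₀))) ⟩
    3 * n * ∑[ v < n ] (a₀ v + b₀ v)
      ≡⟨ *-distribˡ-sum (3 * n) (λ v → a₀ v + b₀ v) ⟩
    ∑[ v < n ] (3 * n * (a₀ v + b₀ v))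
      ≤⟨ ∑-mono (λ v → vertex-inequality (a₀ v) (b₀ v) (col-deleted-Q i v) (row-deleted-P j v)
           (∑-mono λ u → ⊓-monoˡ-≤ 1 (m≤n+m (Q i u v) (P i u v)))
           (∑-mono λ w → ⊓-monoˡ-≤ 1 (m≤m+n (P j v w) (Q j v w)))
           (near i v)) ⟩
    ∑[ v < n ] (2 * (a v * b v) + s * c j v)
      ≡⟨ ∑-distrib-+ (λ v → 2 * (a v * b v)) (λ v → s * c j v) ⟩
    ∑[ v < n ] (2 * (a v * b v)) + ∑[ v < n ] (s * c j v)
      ≡⟨ cong₂ _+_ (*-distribˡ-sum 2 (λ v → a v * b v)) (*-distribˡ-sum s (c j)) ⟨
    2 * paths (D i) (D j) + s * m j ∎
    where
    open ≤-Reasoning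
    j = next i
    s = 4 * n + 2 * r j
    a₀ = col (deleted (Q i))
    b₀ = row (deleted (P j))
    a = col (D i)
    b = row (D j)

  cherry-bound : 3 * (n * (n * n)) ≤ 4 * n * (m 0F + m 1F + m 2F) + 2 * (r 0F * m 0F + r 1F * m 1F + r 2F * m 2F)
  -- The term 2q comes both from expanding products of kept degrees and from the vertex
  -- inequalities, so it cancels.
  cherry-bound = +-cancelˡ-≤ (2 * q) _ _ (begin
    2 * q + 3 * n³                   ≤⟨ +-cancelˡ-≤ (3 * n³) _ _ paths-bound ⟩
    3 * n * (T 0F + T 1F + T 2F)     ≤⟨ *-monoʳ-≤ (3 * n) (+-mono-≤ (+-mono-≤ (total-deleted 0F) (total-deleted 1F)) (total-deleted 2F)) ⟩
    3 * n * (tP 0F + tQ 0F + (tP 1F + tQ 1F) + (tP 2F + tQ 2F))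
      ≡⟨ e₁ n (tP 0F) (tP 1F) (tP 2F) (tQ 0F) (tQ 1F) (tQ 2F) ⟩
    -- Deletions grouped by pair of classes are regrouped by the class of the centre.
    3 * n * (tQ 0F + tP 1F) + 3 * n * (tQ 1F + tP 2F) + 3 * n * (tQ 2F + tP 0F)
      ≤⟨ +-mono-≤ (+-mono-≤ (own-deletions 0F) (own-deletions 1F)) (own-deletions 2F) ⟩
    2 * pD 0F + s 1F * m 1F + (2 * pD 1F + s 2F * m 2F) + (2 * pD 2F + s 0F * m 0F)
      ≡⟨ e₂ n (pD 0F) (pD 1F) (pD 2F) (r 0F) (r 1F) (r 2F) (m 0F) (m 1F) (m 2F) ⟩
    2 * q + (4 * n * (m 0F + m 1F + m 2F) + 2 * (r 0F * m 0F + r 1F * m 1F + r 2F * m 2F)) ∎)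
    where
    open ≤-Reasoning
    n³ = n * (n * n)
    T tP tQ pD pK s : Fin 3 → ℕ
    T i = total (D i)
    tP i = total (deleted (P i))
    tQ i = total (deleted (Q i))
    pD i = paths (D i) (D (next i))
    pK i = paths (K i) (K (next i))
    s i = 4 * n + 2 * r i
    q = pD 0F + pD 1F + pD 2F
    expand : ∀ i → pK i + n * (T i + T (next i)) ≡ n³ + pD i
    expand i = paths-kept (N i) (N (next i))
    e₁ : ∀ n a b c d e f → 3 * n * (a + d + (b + e) + (c + f)) ≡ 3 * n * (d + b) + 3 * n * (e + c) + 3 * n * (f + a)
    e₁ = solve-∀
    e₂ : ∀ n p₀ p₁ p₂ r₀ r₁ r₂ m₀ m₁ m₂ →
      2 * p₀ + (4 * n + 2 * r₁) * m₁ + (2 * p₁ + (4 * n + 2 * r₂) * m₂) + (2 * p₂ + (4 * n + 2 * r₀) * m₀) ≡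
      2 * (p₀ + p₁ + p₂) + (4 * n * (m₀ + m₁ + m₂) + 2 * (r₀ * m₀ + r₁ * m₁ + r₂ * m₂))
    e₂ = solve-∀
    e₃ : ∀ x p₀ p₁ p₂ → 3 * x + (2 * (p₀ + p₁ + p₂) + 3 * x) ≡ 2 * ((x + p₀) + (x + p₁) + (x + p₂))
    e₃ = solve-∀
    e₄ : ∀ n p₀ p₁ p₂ t₀ t₁ t₂ →
      2 * ((p₀ + n * (t₀ + t₁)) + (p₁ + n * (t₁ + t₂)) + (p₂ + n * (t₂ + t₀))) ≡
      (p₀ + p₁) + (p₁ + p₂) + (p₂ + p₀) + 4 * n * (t₀ + t₁ + t₂)
    e₄ = solve-∀
    e₅ : ∀ n k₀ k₁ k₂ t₀ t₁ t₂ →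
      n * k₁ + n * k₂ + n * k₀ + 4 * n * (t₀ + t₁ + t₂) ≡
      n * (k₀ + t₀) + n * (k₁ + t₁) + n * (k₂ + t₂) + 3 * n * (t₀ + t₁ + t₂)
    e₅ = solve-∀
    e₆ : ∀ x → x + x + x ≡ 3 * x
    e₆ = solve-∀
    kt : ∀ i → n * (total (K i) + T i) ≡ n³
    kt i = cong (n *_) (total-kept (N i))
    -- Summing `kept-paths` over `i` counts each kind of kept path twice, whence the factor 2. One
    -- quarter of 4n·ΣT completes the three kept totals to n³ each; the extra 3n³ on both sides
    -- avoids a subtraction.
    paths-bound : 3 * n³ + (2 * q + 3 * n³) ≤ 3 * n³ + 3 * n * (T 0F + T 1F + T 2F)
    paths-bound = begin
      3 * n³ + (2 * q + 3 * n³)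
        ≡⟨ e₃ n³ (pD 0F) (pD 1F) (pD 2F) ⟩
      2 * ((n³ + pD 0F) + (n³ + pD 1F) + (n³ + pD 2F))
        ≡⟨ cong (2 *_) (cong₂ _+_ (cong₂ _+_ (expand 0F) (expand 1F)) (expand 2F)) ⟨
      2 * ((pK 0F + n * (T 0F + T 1F)) + (pK 1F + n * (T 1F + T 2F)) + (pK 2F + n * (T 2F + T 0F)))
        ≡⟨ e₄ n (pK 0F) (pK 1F) (pK 2F) (T 0F) (T 1F) (T 2F) ⟩
      (pK 0F + pK 1F) + (pK 1F + pK 2F) + (pK 2F + pK 0F) + 4 * n * (T 0F + T 1F + T 2F)
        ≤⟨ +-monoˡ-≤ (4 * n * (T 0F + T 1F + T 2F)) (+-mono-≤ (+-mono-≤ (kept-paths 0F) (kept-paths 1F)) (kept-paths 2F)) ⟩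
      n * total (K 1F) + n * total (K 2F) + n * total (K 0F) + 4 * n * (T 0F + T 1F + T 2F)
        ≡⟨ e₅ n (total (K 0F)) (total (K 1F)) (total (K 2F)) (T 0F) (T 1F) (T 2F) ⟩
      n * (total (K 0F) + T 0F) + n * (total (K 1F) + T 1F) + n * (total (K 2F) + T 2F) + 3 * n * (T 0F + T 1F + T 2F)
        ≡⟨ cong (_+ 3 * n * (T 0F + T 1F + T 2F)) (trans (cong₂ _+_ (cong₂ _+_ (kt 0F) (kt 1F)) (kt 2F)) (e₆ n³)) ⟩
      3 * n³ + 3 * n * (T 0F + T 1F + T 2F) ∎

-- From rooks to cherries.

module _ {A : Set} where

  ∑ᴸ : List A → (A → ℕ) → ℕ
  ∑ᴸ rs f = sumᴸ (map f rs)

  ∑-∑ᴸ-swap : ∀ {n} rs (f : Fin n → A → ℕ) → ∑[ i < n ] ∑ᴸ rs (f i) ≡ ∑ᴸ rs (λ x → ∑[ i < n ] f i x)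
  ∑-∑ᴸ-swap {n} []       f = trans (∑-const n 0) (*-zeroʳ n)
  ∑-∑ᴸ-swap     (x ∷ rs) f = trans (∑-distrib-+ (λ i → f i x) (λ i → ∑ᴸ rs (f i)))
                                   (cong (_ +_) (∑-∑ᴸ-swap rs f))

  ∑ᴸ-cong : ∀ rs {f g : A → ℕ} → (∀ x → f x ≡ g x) → ∑ᴸ rs f ≡ ∑ᴸ rs g
  ∑ᴸ-cong []       f≗g = refl
  ∑ᴸ-cong (x ∷ rs) f≗g = cong₂ _+_ (f≗g x) (∑ᴸ-cong rs f≗g)

  term≤∑ᴸ : ∀ {x rs} (f : A → ℕ) → x ∈ₗ rs → f x ≤ ∑ᴸ rs f
  term≤∑ᴸ f (here refl)   = m≤m+n _ _
  term≤∑ᴸ f (there x∈rs)  = ≤-trans (term≤∑ᴸ f x∈rs) (m≤n+m _ _)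

  ∑ᴸ-partition : ∀ rs (g : Fin 3 → A → ℕ) → (∀ x → g 0F x + g 1F x + g 2F x ≡ 1) →
                 ∑ᴸ rs (g 0F) + ∑ᴸ rs (g 1F) + ∑ᴸ rs (g 2F) ≡ length rs
  ∑ᴸ-partition []       g h = refl
  ∑ᴸ-partition (x ∷ rs) g h =
    trans (shuffle (g 0F x) (g 1F x) (g 2F x) _ _ _) (cong₂ _+_ (h x) (∑ᴸ-partition rs g h))
    where
    shuffle : ∀ a b c d e f → a + d + (b + e) + (c + f) ≡ a + b + c + (d + e + f)
    shuffle = solve-∀

δ : ∀ {n} → Fin n → Fin n → ℕ
δ i j = if does (i ≟ j) then 1 else 0

δ-refl : ∀ {n} (i : Fin n) → δ i i ≡ 1
δ-refl i = cong (if_then 1 else 0) (dec-true (i ≟ i) refl)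

∑-δ : ∀ {n} (i : Fin n) → ∑[ j < n ] δ i j ≡ 1
∑-δ {suc n} zero    = cong suc (trans (∑-const n 0) (*-zeroʳ n))
∑-δ {suc n} (suc i) = ∑-δ i

-- A 2-rook is centred at the coordinate index missing from its set of directions: both lines
-- that it covers keep that coordinate, so both deleted edges contain that vertex.
centred : ∀ {n} → Fin 3 → Rook n → ℕ
centred i ρ = if lookup (dirs ρ) i then 0 else 1

centred-total : ∀ {n} (ρ : Rook n) → centred 0F ρ + centred 1F ρ + centred 2F ρ ≡ 1
centred-total (rook _ (true  ∷ true  ∷ false ∷ []) _) = refl
centred-total (rook _ (true  ∷ false ∷ true  ∷ []) _) = refl
centred-total (rook _ (false ∷ true  ∷ true  ∷ []) _) = refl
centred-total (rook _ (false ∷ true  ∷ false ∷ []) ())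
centred-total (rook _ (false ∷ false ∷ true  ∷ []) ())
centred-total (rook _ (false ∷ false ∷ false ∷ []) ())

-- The single missing direction is not `i`, so the centre lies in one of the other two classes. The
-- line in direction `i` is thus an edge of the rook's cherry.
centred-next : ∀ {n} (ρ : Rook n) i → i ∈ dirs ρ → centred (next i) ρ + centred (next (next i)) ρ ≡ 1
centred-next ρ i i∈ρ = trans (cong (_+ (centred (next i) ρ + centred (next (next i)) ρ)) (sym centred-i≡0)) (cyclic i)
  where
  centred-i≡0 : centred i ρ ≡ 0
  centred-i≡0 = cong (if_then 0 else 1) ([]=⇒lookup i∈ρ)
  rotate : ∀ a b c → a + (b + c) ≡ c + a + b
  rotate = solve-∀
  cyclic : ∀ i → centred i ρ + (centred (next i) ρ + centred (next (next i)) ρ) ≡ 1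
  cyclic 0F = trans (sym (+-assoc (centred 0F ρ) _ _)) (centred-total ρ)
  cyclic 1F = trans (rotate (centred 1F ρ) (centred 2F ρ) (centred 0F ρ)) (centred-total ρ)
  cyclic 2F = trans (+-comm (centred 2F ρ) _) (centred-total ρ)

direction : ∀ {n} (ρ : Rook n) → ∃ λ i → i ∈ dirs ρ
direction (rook _ (true  ∷ _    ∷ _ ∷ []) _) = 0F , here
direction (rook _ (false ∷ true ∷ _ ∷ []) _) = 1F , there here
direction (rook _ (false ∷ false ∷ true  ∷ []) ())
direction (rook _ (false ∷ false ∷ false ∷ []) ())

next≢ : ∀ i → next i ≢ i
next≢ 0F ()
next≢ 1F ()
next≢ 2F ()

next²≢ : ∀ i → next (next i) ≢ i
next²≢ 0F ()
next²≢ 1F ()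
next²≢ 2F ()

module FromRooks {n : ℕ} (rs : List (Rook n)) (covers : ∀ Q → Any (λ ρ → Covers ρ Q) rs) where

  at : Fin 3 → Rook n → Fin n → ℕ
  at i ρ u = δ (lookup (pos ρ) i) u

  edge : Fin 3 → Rook n → Matrix n
  edge i ρ u v = at i ρ u * at (next i) ρ v

  P Q : Fin 3 → Matrix n
  P i u v = ∑ᴸ rs λ ρ → centred i ρ * edge i ρ u v
  Q i u v = ∑ᴸ rs λ ρ → centred (next i) ρ * edge i ρ u v

  c : Fin 3 → Fin n → ℕ
  c i u = ∑ᴸ rs λ ρ → centred i ρ * at i ρ u

  ∑-at : ∀ i ρ → ∑[ u < n ] at i ρ u ≡ 1
  ∑-at i ρ = ∑-δ (lookup (pos ρ) i)

  row-P : ∀ i u → row (P i) u ≡ c i u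
  row-P i u = trans (∑-∑ᴸ-swap rs λ v ρ → centred i ρ * edge i ρ u v) (∑ᴸ-cong rs λ ρ → begin
    ∑[ v < n ] (centred i ρ * (at i ρ u * at (next i) ρ v))
      ≡⟨ sum-cong-≗ (λ v → sym (*-assoc (centred i ρ) (at i ρ u) (at (next i) ρ v))) ⟩
    ∑[ v < n ] (centred i ρ * at i ρ u * at (next i) ρ v)
      ≡⟨ *-distribˡ-sum (centred i ρ * at i ρ u) (at (next i) ρ) ⟨
    centred i ρ * at i ρ u * ∑[ v < n ] (at (next i) ρ v)
      ≡⟨ trans (cong (centred i ρ * at i ρ u *_) (∑-at (next i) ρ)) (*-identityʳ _) ⟩
    centred i ρ * at i ρ u ∎)
    where open ≡-Reasoning

  col-Q : ∀ i v → col (Q i) v ≡ c (next i) v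
  col-Q i v = trans (∑-∑ᴸ-swap rs λ u ρ → centred (next i) ρ * edge i ρ u v) (∑ᴸ-cong rs λ ρ → begin
    ∑[ u < n ] (centred (next i) ρ * (at i ρ u * at (next i) ρ v))
      ≡⟨ sum-cong-≗ (λ u → rotate (centred (next i) ρ) (at i ρ u) (at (next i) ρ v)) ⟩
    ∑[ u < n ] (centred (next i) ρ * at (next i) ρ v * at i ρ u)
      ≡⟨ *-distribˡ-sum (centred (next i) ρ * at (next i) ρ v) (at i ρ) ⟨
    centred (next i) ρ * at (next i) ρ v * ∑[ u < n ] (at i ρ u)
      ≡⟨ trans (cong (centred (next i) ρ * at (next i) ρ v *_) (∑-at i ρ)) (*-identityʳ _) ⟩
    centred (next i) ρ * at (next i) ρ v ∎)
    where
    open ≡-Reasoning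
    rotate : ∀ x y z → x * (y * z) ≡ x * z * y
    rotate = solve-∀

  ∑c : ∀ i → ∑[ u < n ] c i u ≡ ∑ᴸ rs (centred i)
  ∑c i = trans (∑-∑ᴸ-swap rs λ u ρ → centred i ρ * at i ρ u) (∑ᴸ-cong rs λ ρ →
    trans (sym (*-distribˡ-sum (centred i ρ) (at i ρ))) (trans (cong (centred i ρ *_) (∑-at i ρ)) (*-identityʳ _)))

  N : Fin 3 → Matrix n
  N i = P i ⊕ Q i

  -- The hypothesis puts the rook's centre at one end of the edge, so the rook contributes 1 to
  -- exactly one of the two sums.
  edge-hit : ∀ {ρ} i → ρ ∈ₗ rs → centred i ρ + centred (next i) ρ ≡ 1 →
             0 < N i (lookup (pos ρ) i) (lookup (pos ρ) (next i))
  edge-hit {ρ} i ρ∈rs h = begin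
    1                                 ≡⟨ h ⟨
    centred i ρ + centred (next i) ρ  ≡⟨ cong₂ _+_ (unit (centred i ρ)) (unit (centred (next i) ρ)) ⟩
    centred i ρ * edge i ρ u v + centred (next i) ρ * edge i ρ u v
      ≤⟨ +-mono-≤ (term≤∑ᴸ (λ ρ → centred i ρ * edge i ρ u v) ρ∈rs) (term≤∑ᴸ (λ ρ → centred (next i) ρ * edge i ρ u v) ρ∈rs) ⟩
    N i u v                           ∎
    where
    open ≤-Reasoning
    u = lookup (pos ρ) i
    v = lookup (pos ρ) (next i)
    unit : ∀ x → x ≡ x * edge i ρ u v
    unit x = sym (trans (cong (x *_) (cong₂ _*_ (δ-refl u) (δ-refl v))) (*-identityʳ x))

  -- A point covered in direction `i` shares its other two coordinates with the rook, and these span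
  -- a deleted edge. For the rook's own position, any of its directions serves.
  point-hit : ∀ p → ∃ λ i → 0 < N (next i) (lookup p (next i)) (lookup p (next (next i)))
  point-hit p with find (covers p)
  ... | ρ , ρ∈rs , inj₁ refl with direction ρ
  ...   | i , i∈ρ = i , edge-hit (next i) ρ∈rs (centred-next ρ i i∈ρ)
  point-hit p | ρ , ρ∈rs , inj₂ (i , i∈ρ , _ , same) =
    i , subst₂ (λ u v → 0 < N (next i) u v) (sym (same _ (next≢ i))) (sym (same _ (next²≢ i)))
               (edge-hit (next i) ρ∈rs (centred-next ρ i i∈ρ))

  hit₀ : ∀ x y z → 0 < N 0F x y + (N 1F y z + N 2F z x)
  hit₀ x y z with point-hit (x ∷ y ∷ z ∷ [])
  ... | 0F , h = ≤-trans h (≤-trans (m≤m+n (N 1F y z) _) (m≤n+m (N 1F y z + N 2F z x) (N 0F x y)))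
  ... | 1F , h = ≤-trans h (≤-trans (m≤n+m (N 2F z x) (N 1F y z)) (m≤n+m (N 1F y z + N 2F z x) (N 0F x y)))
  ... | 2F , h = ≤-trans h (m≤m+n (N 0F x y) _)

  hit : ∀ i x y z → 0 < N i x y + (N (next i) y z + N (next (next i)) z x)
  hit 0F x y z = hit₀ x y z
  -- The same triangle, with its vertices listed from class 0 again.
  hit 1F x y z = subst (0 <_) (rotate (N 0F z x) (N 1F x y) (N 2F y z)) (hit₀ z x y)
    where
    rotate : ∀ a b c → a + (b + c) ≡ b + (c + a)
    rotate = solve-∀
  hit 2F x y z = subst (0 <_) (rotate (N 0F y z) (N 1F z x) (N 2F x y)) (hit₀ y z x)
    where
    rotate : ∀ a b c → a + (b + c) ≡ c + (a + b)
    rotate = solve-∀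

  open Cherries P Q c row-P col-Q hit public using (m; r; r²≤; cherry-bound)

  ∑m : m 0F + m 1F + m 2F ≡ length rs
  ∑m = trans (cong₂ _+_ (cong₂ _+_ (∑c 0F) (∑c 1F)) (∑c 2F)) (∑ᴸ-partition rs centred centred-total)

-- The lower bound for coverings and for the limit.

covering-length-bound : ∀ {n} rs → IsCovering n rs → ∃ λ w →
  3 * (n * (n * n)) ≤ 4 * n * length rs + 2 * w ×
  3 * (w * w) ≤ 2 * (length rs * (length rs * length rs))
covering-length-bound {n} rs (_ , covers) =
  w , subst (λ z → 3 * (n * (n * n)) ≤ 4 * n * z + 2 * w) ∑m cherry-bound
    , subst (λ z → 3 * (w * w) ≤ 2 * (z * (z * z))) ∑m
        (3w²≤2m³ (r 0F) (r 1F) (r 2F) (m 0F) (m 1F) (m 2F) (r²≤ 0F) (r²≤ 1F) (r²≤ 2F))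
  where
  open FromRooks rs covers
  w = r 0F * m 0F + r 1F * m 1F + r 2F * m 2F

-- The limit is bounded through rationals: every a/b strictly below the irrational constant is
-- eventually a lower bound for the ratios m/n², hence for their limit.
theorem14 : (a b : ℕ) → 0 < b → BelowBound a b →
    Σ ℕ (λ N → (n m : ℕ) → N ≤ n → IsA n m → a * (n * n) ≤ b * m)
-- The counting has no error term, so every n ≥ 1 works; positivity makes n² a valid denominator.
theorem14 a b 0<b below = 1 , λ where
  n _ 1≤n ((rs , covering , refl) , _) → ≮⇒≥ λ bm<an² →
    let w , 3n³≤ , 3w²≤ = covering-length-bound rs covering
    in ¬BelowBound n (length rs) w 3n³≤ 3w²≤ (BelowBound-mono {a} {b} 0<b (*-mono-≤ 1≤n 1≤n) bm<an² below)
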